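{- A countably-based $T_1$-space $\mathbf{X}$ is quasi-Polish if and only if $\mathrm{VC}_{\mathbf{X}}$ is continuous.
   Context: A represented space $\mathbf{X}=(X,\delta_X)$ is a set $X$ with a partial surjection $\delta_X:\subseteq\mathbb{N}^{\mathbb{N}}\to X$. A partial multivalued function $f:\subseteq\mathbf{X}\rightrightarrows\mathbf{Y}$ between represented spaces is continuous if it has a continuous realizer, i.e. a continuous partial $F:\subseteq\mathbb{N}^{\mathbb{N}}\to\mathbb{N}^{\mathbb{N}}$ with $\delta_Y(F(p))\in f(\delta_X(p))$ for all $p\in\mathrm{dom}(f\circ\delta_X)$. A countably-based ($T_0$) topological space $\mathbf{X}$ with countable basis $(B_n)_{n\in\mathbb{N}}$ is regarded as a represented space by its standard (admissible) representation: a name of $x$ is an enumeration of $\{n\mid x\in B_n\}$. $\mathcal{V}(\mathbf{X})$ is the space of closed subsets of $\mathbf{X}$, where a name of a closed set $A$ is an enumeration of $\{n\in\mathbb{N}\mid B_n\cap A\neq\emptyset\}$. Overt choice $\mathrm{VC}_{\mathbf{X}}:\subseteq\mathcal{V}(\mathbf{X})\rightrightarrows\mathbf{X}$ has domain $\{A\in\mathcal{V}(\mathbf{X})\mid A\neq\emptyset\}$, and $x\in\mathrm{VC}_{\mathbf{X}}(A)$ iff $x\in A$. (Continuity of $\mathrm{VC}_{\mathbf{X}}$ does not depend on the choice of the basis.) A topological space is quasi-Polish if it is homeomorphic to a (boldface) $\boldsymbol{\Pi}^0_2$-subspace of the power set of $\mathbb{N}$ with the Scott topology, where a $\boldsymbol{\Pi}^0_2$-subset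 of a space $Z$ is a set of the form $\{z\in Z\mid\forall n\ (z\in U_n\Rightarrow z\in V_n)\}$ with sequences of open sets $(U_n)_n,(V_n)_n$. Equivalently, it is a countably-based completely quasi-metrizable space. -}

module Defs where

open import Axiom.ExcludedMiddle using (ExcludedMiddle)
open import Data.Empty using (⊥-elim)
open import Data.Nat.Base using (ℕ; suc; _<_)
open import Data.Nat.Properties using (suc-injective)
open import Data.Product.Base using (Σ; Σ-syntax; ∃; _×_; _,_; proj₁; proj₂)
open import Data.Sum.Base using (_⊎_; inj₁; inj₂)
open import Data.Unit.Polymorphic.Base using (⊤; tt)
open import Function.Base using (id; _∘_)
open import Function.Bundles using (Inverse; _⇔_; mk⇔; Equivalence)
open import Level using (Level; Setω; _⊔_; 0ℓ) renaming (suc to lsuc)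
open import Relation.Binary.Bundles using (Setoid; Poset)
open import Relation.Binary.Core using (REL)
open import Relation.Binary.Definitions using (_Respects_)
open import Relation.Binary.PropositionalEquality.Core
  using (_≡_; _≗_; refl; sym; trans)
import Relation.Binary.Construct.On as On
open import Relation.Nullary using (¬_; Dec; yes; no)
open import Relation.Unary
  using (Pred; _∈_; _∉_; _⊆_; _≐_; _≬_; _∩_; _⊢_; ⋃; ∁)
open import Relation.Unary.Relation.Binary.Subset using (⊆-poset)

-- The ambient logic of the mathematics is classical.  `Dec P` for every type P
-- (not only for propositions) also makes every existence proof a choice of
-- witness, so no separate choice principle is needed.

LEM : Setω
LEM = ∀ (ℓ : Level) → ExcludedMiddle ℓ

-- Points form a setoid because the power set of ℕ is one.  Subsets live at
-- level c ⊔ ℓ, which is large enough for a union of open sets indexed by the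
-- points of a subset to be again of that level.

record TopologicalSpace (c ℓ p : Level) : Set (lsuc (c ⊔ ℓ ⊔ p)) where
  field
    points : Setoid c ℓ

  open Setoid points public using (Carrier; _≈_)

  Subset : Set (lsuc (c ⊔ ℓ))
  Subset = Pred Carrier (c ⊔ ℓ)

  field
    IsOpen      : Pred Subset p
    open-resp-≈ : ∀ {U} → IsOpen U → U Respects _≈_
    open-resp-≐ : ∀ {U V} → U ≐ V → IsOpen U → IsOpen V
    open-⊤      : IsOpen (λ _ → ⊤)
    open-∩      : ∀ {U V} → IsOpen U → IsOpen V → IsOpen (U ∩ V)
    open-⋃      : ∀ {I : Set (c ⊔ ℓ)} {U : I → Subset} →
                  (∀ i → IsOpen (U i)) → IsOpen (⋃ I U)

-- The subsets of X and of Y may live at different levels, so the preimage is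
-- asked to be extensionally equal to an open set.

IsContinuous : ∀ {c ℓ p c′ ℓ′ p′}
               (X : TopologicalSpace c ℓ p) (Y : TopologicalSpace c′ ℓ′ p′) →
               (TopologicalSpace.Carrier X → TopologicalSpace.Carrier Y) →
               Set (lsuc (c ⊔ ℓ ⊔ c′ ⊔ ℓ′) ⊔ p ⊔ p′)
IsContinuous {c} {ℓ} {_} {c′} {ℓ′} X Y f =
  ∀ (V : Y.Subset) → Y.IsOpen V →
  Σ[ U ∈ X.Subset ] (X.IsOpen U × U ≐ (f ⊢ V))
  where
  module X = TopologicalSpace X
  module Y = TopologicalSpace Y

record _≅_ {c ℓ p c′ ℓ′ p′ : Level}
           (X : TopologicalSpace c ℓ p) (Y : TopologicalSpace c′ ℓ′ p′)
           : Set (lsuc (c ⊔ ℓ ⊔ c′ ⊔ ℓ′) ⊔ p ⊔ p′) where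
  field
    bijection : Inverse (TopologicalSpace.points X) (TopologicalSpace.points Y)
  open Inverse bijection public using (to; from)
  field
    to-continuous   : IsContinuous X Y to
    from-continuous : IsContinuous Y X from

Subspace : ∀ {c ℓ p} (Z : TopologicalSpace c ℓ p) →
           TopologicalSpace.Subset Z →
           TopologicalSpace (c ⊔ ℓ) ℓ (lsuc (c ⊔ ℓ) ⊔ p)
Subspace Z P = record
  { points      = On.setoid Z.points π
  ; IsOpen      = λ W → Σ[ U ∈ Z.Subset ] (Z.IsOpen U × W ≐ (π ⊢ U))
  ; open-resp-≈ = λ (U , oU , W⊆U , U⊆W) x≈y x∈W →
      U⊆W (Z.open-resp-≈ oU x≈y (W⊆U x∈W))
  ; open-resp-≐ = λ (W⊆W′ , W′⊆W) (U , oU , W⊆U , U⊆W) →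
      U , oU , W⊆U ∘ W′⊆W , W⊆W′ ∘ U⊆W
  ; open-⊤      = (λ _ → ⊤) , Z.open-⊤ , id , id
  ; open-∩      = λ (U , oU , W⊆U , U⊆W) (U′ , oU′ , W′⊆U′ , U′⊆W′) →
      (U ∩ U′) , Z.open-∩ oU oU′
      , (λ (a , b) → W⊆U a , W′⊆U′ b) , (λ (a , b) → U⊆W a , U′⊆W′ b)
  ; open-⋃      = λ {I} h →
      ⋃ I (λ i → proj₁ (h i)) , Z.open-⋃ (λ i → proj₁ (proj₂ (h i)))
      , (λ (i , w) → i , proj₁ (proj₂ (proj₂ (h i))) w)
      , (λ (i , u) → i , proj₂ (proj₂ (proj₂ (h i))) u)
  }
  where
  module Z = TopologicalSpace Z
  π : Σ Z.Carrier P → Z.Carrier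
  π = proj₁

module _ {c ℓ p : Level} (X : TopologicalSpace c ℓ p) where
  open TopologicalSpace X

  T₀ : Set (lsuc (c ⊔ ℓ) ⊔ p)
  T₀ = ∀ {x y} → ¬ (x ≈ y) →
       Σ[ U ∈ Subset ] (IsOpen U × ((x ∈ U × y ∉ U) ⊎ (y ∈ U × x ∉ U)))

  T₁ : Set (lsuc (c ⊔ ℓ) ⊔ p)
  T₁ = ∀ {x y} → ¬ (x ≈ y) → Σ[ U ∈ Subset ] (IsOpen U × x ∈ U × y ∉ U)

  T₁⇒T₀ : T₁ → T₀
  T₁⇒T₀ t₁ x≉y with t₁ x≉y
  ... | U , oU , x∈U , y∉U = U , oU , inj₁ (x∈U , y∉U)

  record CountableBasis : Set (lsuc (c ⊔ ℓ) ⊔ p) where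
    field
      B       : ℕ → Subset
      B-open  : ∀ n → IsOpen (B n)
      B-basis : ∀ {U x} → IsOpen U → x ∈ U → ∃ λ n → x ∈ B n × B n ⊆ U

  record ClosedSet : Set (lsuc (c ⊔ ℓ) ⊔ p) where
    field
      set         : Subset
      set-resp-≈  : set Respects _≈_
      ∁-open      : IsOpen (∁ set)

  IsΠ⁰₂ : Pred Subset (lsuc (c ⊔ ℓ) ⊔ p)
  IsΠ⁰₂ P = Σ[ U ∈ (ℕ → Subset) ] Σ[ V ∈ (ℕ → Subset) ]
    ((∀ n → IsOpen (U n)) × (∀ n → IsOpen (V n)) ×
     P ≐ (λ z → ∀ n → z ∈ U n → z ∈ V n))

IsDirected : {I : Set} → (I → Pred ℕ 0ℓ) → Set
IsDirected {I} F = I × (∀ i j → ∃ λ k → F i ⊆ F k × F j ⊆ F k)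

IsScottOpen : Pred (Pred (Pred ℕ 0ℓ) (lsuc 0ℓ)) (lsuc 0ℓ)
IsScottOpen U =
  (∀ {S T} → S ⊆ T → S ∈ U → T ∈ U) ×
  (∀ {I : Set} (F : I → Pred ℕ 0ℓ) → IsDirected F → ⋃ I F ∈ U → ∃ λ i → F i ∈ U)

𝒫ℕ : TopologicalSpace (lsuc 0ℓ) 0ℓ (lsuc 0ℓ)
𝒫ℕ = record
  { points      = Poset.Eq.setoid (⊆-poset ℕ 0ℓ)
  ; IsOpen      = IsScottOpen
  ; open-resp-≈ = λ (up , _) (S⊆T , _) → up S⊆T
  ; open-resp-≐ = λ (U⊆V , V⊆U) (up , inacc) →
      (λ S⊆T → U⊆V ∘ up S⊆T ∘ V⊆U) ,
      (λ F dir h → let i , q = inacc F dir (V⊆U h) in i , U⊆V q)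
  ; open-⊤      = (λ _ _ → tt) , (λ F (i , _) _ → i , tt)
  ; open-∩      = λ (up , inacc) (up′ , inacc′) →
      (λ S⊆T (a , b) → up S⊆T a , up′ S⊆T b) ,
      (λ F dir (a , b) →
        let i , q     = inacc F dir a
            j , r     = inacc′ F dir b
            k , s , t = proj₂ dir i j
        in k , up s q , up′ t r)
  ; open-⋃      = λ h →
      (λ S⊆T (i , a) → i , proj₁ (h i) S⊆T a) ,
      (λ F dir (i , a) → let j , q = proj₂ (h i) F dir a in j , i , q)
  }

IsQuasiPolish : ∀ {c ℓ p} → TopologicalSpace c ℓ p → Set (lsuc (lsuc 0ℓ) ⊔ lsuc (c ⊔ ℓ) ⊔ p)
IsQuasiPolish X =
  Σ[ P ∈ TopologicalSpace.Subset 𝒫ℕ ] (IsΠ⁰₂ 𝒫ℕ P × X ≅ Subspace 𝒫ℕ P)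

Baire : Set
Baire = ℕ → ℕ

_≡[_]_ : Baire → ℕ → Baire → Set
p ≡[ n ] q = ∀ i → i < n → p i ≡ q i

-- `_δ_` is the graph of the partial surjection.

record RepresentedSpace (c ℓ r : Level) : Set (lsuc (c ⊔ ℓ ⊔ r)) where
  field
    points : Setoid c ℓ

  open Setoid points public using (Carrier; _≈_)

  field
    _δ_          : REL Baire Carrier r
    δ-resp       : ∀ {p q x y} → p ≗ q → x ≈ y → p δ x → q δ y
    δ-functional : ∀ {p x y} → p δ x → p δ y → x ≈ y
    δ-surjective : ∀ x → ∃ λ p → p δ x

record Multifunction {c ℓ r c′ ℓ′ r′ : Level}
                     (X : RepresentedSpace c ℓ r) (Y : RepresentedSpace c′ ℓ′ r′)
                     (m : Level) : Set (c ⊔ ℓ ⊔ c′ ⊔ ℓ′ ⊔ lsuc m) where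
  private
    module X = RepresentedSpace X
    module Y = RepresentedSpace Y
  field
    _↦_    : REL X.Carrier Y.Carrier m
    ↦-resp : ∀ {x x′ y y′} → x X.≈ x′ → y Y.≈ y′ → x ↦ y → x′ ↦ y′

  dom : Pred X.Carrier (c′ ⊔ m)
  dom x = ∃ λ y → x ↦ y

-- `continuous` also says that the value does not depend on the proof of
-- definedness and respects pointwise equality.

record ContinuousPartialMap (d : Level) : Set (lsuc d) where
  field
    dom        : Pred Baire d
    dom-resp   : dom Respects _≗_
    map        : ∀ p → p ∈ dom → Baire
    continuous : ∀ p (p∈ : p ∈ dom) n → ∃ λ m →
                 ∀ q (q∈ : q ∈ dom) → p ≡[ m ] q → map p p∈ ≡[ n ] map q q∈

module _ {c ℓ r c′ ℓ′ r′ m : Level}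
         {X : RepresentedSpace c ℓ r} {Y : RepresentedSpace c′ ℓ′ r′} where
  private
    module X = RepresentedSpace X
    module Y = RepresentedSpace Y

  IsRealizer : ∀ {d} → ContinuousPartialMap d → Multifunction X Y m →
               Set (c ⊔ r ⊔ c′ ⊔ r′ ⊔ m ⊔ d)
  IsRealizer F f =
    ∀ p x → p X.δ x → x ∈ f.dom →
    Σ[ p∈ ∈ p ∈ F.dom ] ∃ λ y → F.map p p∈ Y.δ y × x f.↦ y
    where
    module F = ContinuousPartialMap F
    module f = Multifunction f

  -- The level is that of the predicate "p names a point of dom f".

  Continuous : Multifunction X Y m → Set (lsuc (c ⊔ r ⊔ c′ ⊔ m) ⊔ r′)
  Continuous f =
    Σ[ F ∈ ContinuousPartialMap (c ⊔ r ⊔ c′ ⊔ m) ] IsRealizer F f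

-- The value 0 enumerates nothing, so that the empty set (the hit set of the
-- empty closed set) has an enumeration.

_Enumerates_ : ∀ {a} → Baire → Pred ℕ a → Set a
p Enumerates S = ∀ n → (∃ λ i → p i ≡ suc n) ⇔ n ∈ S

enumerates-resp : ∀ {a b} {S : Pred ℕ a} {T : Pred ℕ b} {p q} →
                  p ≗ q → S ≐ T → p Enumerates S → q Enumerates T
enumerates-resp p≗q (S⊆T , T⊆S) e n = mk⇔
  (λ (i , qi≡) → S⊆T (Equivalence.to (e n) (i , trans (p≗q i) qi≡)))
  (λ n∈T → let i , pi≡ = Equivalence.from (e n) (T⊆S n∈T)
           in i , trans (sym (p≗q i)) pi≡)

enumerates-unique : ∀ {a b} {S : Pred ℕ a} {T : Pred ℕ b} {p} →
                    p Enumerates S → p Enumerates T → S ≐ T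
enumerates-unique e e′ =
  (λ {n} n∈S → Equivalence.to (e′ n) (Equivalence.from (e n) n∈S)) ,
  (λ {n} n∈T → Equivalence.to (e n) (Equivalence.from (e′ n) n∈T))

private
  mark : ∀ {a} {P : Set a} → Dec P → ℕ → ℕ
  mark (yes _) n = suc n
  mark (no  _) n = 0

  mark-yes : ∀ {a} {P : Set a} (P? : Dec P) n → P → mark P? n ≡ suc n
  mark-yes (yes _)  n x = refl
  mark-yes (no ¬P) n x = ⊥-elim (¬P x)

  mark-inv : ∀ {a} (S : Pred ℕ a) i (S? : Dec (S i)) {n} →
             mark S? i ≡ suc n → S n
  mark-inv S i (yes x) refl = x

enumerable : LEM → ∀ {a} (S : Pred ℕ a) → ∃ λ p → p Enumerates S
enumerable lem {a} S = (λ i → mark (lem a {S i}) i) , λ n → mk⇔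
  (λ (i , eq) → mark-inv S i (lem a) eq)
  (λ n∈S → n , mark-yes (lem a) n n∈S)

module _ (lem : LEM) {c ℓ p : Level} {X : TopologicalSpace c ℓ p}
         (basis : CountableBasis X) where
  open TopologicalSpace X
  open CountableBasis basis
  open ClosedSet

  private
    module S = Setoid points

    stable : ∀ {a} {P : Set a} → ¬ ¬ P → P
    stable {a} {P} ¬¬P with lem a {P}
    ... | yes x = x
    ... | no ¬P = ⊥-elim (¬¬P ¬P)

    basics⊆⇒open⊆ : ∀ {x y} → (λ n → x ∈ B n) ⊆ (λ n → y ∈ B n) →
                    ∀ {U} → IsOpen U → x ∈ U → y ∈ U
    basics⊆⇒open⊆ h oU x∈U = let n , x∈B , B⊆U = B-basis oU x∈U in B⊆U (h x∈B)

    hits⊆⇒⊆ : (A A′ : ClosedSet X) →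
              (λ n → B n ≬ set A) ⊆ (λ n → B n ≬ set A′) → set A ⊆ set A′
    hits⊆⇒⊆ A A′ h {x} x∈A = stable λ x∉A′ →
      let n , x∈B , B⊆∁A′   = B-basis (∁-open A′) x∉A′
          y , y∈B , y∈A′    = h (x , x∈B , x∈A)
      in B⊆∁A′ y∈B y∈A′

  standardRepresentation : T₀ X → RepresentedSpace c ℓ (c ⊔ ℓ)
  standardRepresentation t₀ = record
    { points       = points
    ; _δ_          = λ q x → q Enumerates (λ n → x ∈ B n)
    ; δ-resp       = λ q≗q′ x≈y → enumerates-resp q≗q′
        ( (λ {n} → open-resp-≈ (B-open n) x≈y)
        , (λ {n} → open-resp-≈ (B-open n) (S.sym x≈y)))
    ; δ-functional = functional
    ; δ-surjective = λ x → enumerable lem (λ n → x ∈ B n)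
    }
    where
    functional : ∀ {q x y} → q Enumerates (λ n → x ∈ B n) →
                 q Enumerates (λ n → y ∈ B n) → x ≈ y
    functional e e′ = stable λ x≉y → separated (t₀ x≉y)
      where
      separated : ¬ _
      separated (U , oU , inj₁ (x∈U , y∉U)) =
        y∉U (basics⊆⇒open⊆ (proj₁ (enumerates-unique e e′)) oU x∈U)
      separated (U , oU , inj₂ (y∈U , x∉U)) =
        x∉U (basics⊆⇒open⊆ (proj₂ (enumerates-unique e e′)) oU y∈U)

  𝒱 : RepresentedSpace (lsuc (c ⊔ ℓ) ⊔ p) (c ⊔ ℓ) (c ⊔ ℓ)
  𝒱 = record
    { points       = record
      { Carrier       = ClosedSet X
      ; _≈_           = λ A A′ → set A ≐ set A′
      ; isEquivalence = record
        { refl  = id , id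
        ; sym   = λ (f , g) → g , f
        ; trans = λ (f , g) (f′ , g′) → f′ ∘ f , g ∘ g′
        }
      }
    ; _δ_          = λ q A → q Enumerates (λ n → B n ≬ set A)
    ; δ-resp       = λ q≗q′ (A⊆A′ , A′⊆A) → enumerates-resp q≗q′
        ( (λ (x , x∈B , x∈A) → x , x∈B , A⊆A′ x∈A)
        , (λ (x , x∈B , x∈A′) → x , x∈B , A′⊆A x∈A′))
    ; δ-functional = λ {_} {A} {A′} e e′ →
        let f , g = enumerates-unique e e′ in hits⊆⇒⊆ A A′ f , hits⊆⇒⊆ A′ A g
    ; δ-surjective = λ A → enumerable lem (λ n → B n ≬ set A)
    }

  VC : (t₀ : T₀ X) → Multifunction 𝒱 (standardRepresentation t₀) (c ⊔ ℓ)
  VC t₀ = record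
    { _↦_    = λ A x → x ∈ set A
    ; ↦-resp = λ {A} (A⊆A′ , _) x≈y x∈A → A⊆A′ (set-resp-≈ A x≈y x∈A)
    }

-- Quasi-Polish ⇒ continuous.  Embed X in 𝒫ℕ as {S | ∀ n, S ∈ U n ⇒ S ∈ V n}.  Given
-- the list of basic sets that A hits, walk down basic sets B(a₀) ⊇ B(a₁) ⊇ … from
-- that list and let S be the increasing union of the sets ⋂ {f x | x ∈ B(aₜ)}, f being
-- the embedding.  If the t-th of them is in U n, some point of A ∩ B(aₜ) is in V n,
-- and Scott openness of V n provides a next basic set that puts S into V n.  The point
-- S lies in A, because each of its Scott neighbourhoods contains some f y with y ∈ A.
--
-- Continuous ⇒ quasi-Polish.  A realizer F yields a winning strategy for the second
-- player in the strong Choquet game.  Feed F a name of the closed set {x₀, …, xₖ} in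
-- such a way that its output has already discarded x₀, …, xₖ₋₁, and answer xₖ with the
-- intersection of the sets containing xₖ among those read and written so far.  After
-- the opponent moves to xₖ₊₁ in it, the part of the name read so far is also the
-- beginning of a name of {x₀, …, xₖ₋₁, xₖ₊₁}, on which F must converge to xₖ₊₁ and so
-- discards xₖ; then xₖ can be listed again.  In the limit F reads a name of the
-- closure of all the xₖ, and its output names a point in all the sets played, which
-- moreover form a neighbourhood basis of it.  By second countability the game tree can
-- be pruned to a countable one, and "every node whose open set belongs to S has a child
-- inside B n whose open set belongs to S, for n ∈ S" is a Π⁰₂ condition on S ∈ 𝒫ℕ
-- satisfied exactly by the neighbourhood filters of points, for upwards closed S.

module Submission where

open import Defs
open import Data.Bool.Base using (if_then_else_)
open import Data.Empty using (⊥-elim)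
open import Data.Empty.Polymorphic using (⊥)
open import Data.List.Base using (List; []; _∷_)
open import Data.Nat.Base using (ℕ; zero; suc; _+_; _≤_; _<_; _⊔_; z≤n; s≤s; s≤s⁻¹)
open import Data.Nat.Properties
open import Data.Product.Base using (Σ-syntax; ∃; _×_; _,_; proj₁; proj₂; map₂)
open import Data.Product.Function.NonDependent.Propositional using (_×-↠_)
open import Data.Sum.Base using (_⊎_; inj₁; inj₂; [_,_]; [_,_]′)
open import Data.Sum.Function.Propositional using (_⊎-↠_)
open import Data.Unit.Polymorphic.Base using (⊤; tt)
open import Function.Base using (id; _∘_)
open import Function.Bundles using (Inverse; _⇔_; mk⇔; Equivalence; _↠_; mk↠ₛ; Surjection)
open import Function.Construct.Composition using (_↠-∘_)
open import Function.Construct.Identity using (↠-id)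
open import Level using (Lift; lift; 0ℓ) renaming (suc to lsuc; _⊔_ to _⊔ˡ_)
open import Relation.Binary.Bundles using (Setoid)
open import Relation.Binary.Definitions using (tri<; tri≈; tri>)
open import Relation.Binary.PropositionalEquality
  using (_≡_; refl; sym; trans; cong; subst)
open import Relation.Nullary using (¬_; Dec; yes; no; contradiction)
open import Relation.Nullary.Decidable using (True; toWitness; fromWitness; does; decidable-stable)
open import Relation.Unary using (Pred; _∈_; _∉_; _⊆_; _≐_; _≬_; _∩_; _⊢_; ⋃)

-- Enumerations of pairs, sums and lists.

diagonal-step : ℕ × ℕ → ℕ × ℕ
diagonal-step (zero  , y) = suc y , zero
diagonal-step (suc x , y) = x , suc y

unpair : ℕ → ℕ × ℕ
unpair zero    = zero , zero
unpair (suc t) = diagonal-step (unpair t)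

unpair-sum : ∀ t → proj₁ (unpair t) + proj₂ (unpair t) ≤ t
unpair-sum zero = z≤n
unpair-sum (suc t) with unpair t | unpair-sum t
... | zero  , y | h = s≤s (≤-trans (≤-reflexive (+-identityʳ y)) h)
... | suc x , y | h = ≤-trans (≤-reflexive (+-suc x y)) (m≤n⇒m≤1+n h)

unpair-fst : ∀ t → proj₁ (unpair t) ≤ t
unpair-fst t = ≤-trans (m≤m+n _ _) (unpair-sum t)

-- Induction backwards along the walk: within an antidiagonal on `y`, then to the end of the
-- preceding antidiagonal.
unpair-onto : ∀ s y x → y + x ≡ s → ∃ λ t → unpair t ≡ (x , y)
unpair-onto zero    zero    zero    _  = zero , refl
unpair-onto s       (suc y) x       eq =
  let t , e = unpair-onto s y (suc x) (trans (+-suc y x) eq)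
  in suc t , cong diagonal-step e
unpair-onto (suc s) zero    (suc x) eq =
  let t , e = unpair-onto s x zero (trans (+-identityʳ x) (suc-injective eq))
  in suc t , cong diagonal-step e

pair : ∀ x y → ∃ λ t → unpair t ≡ (x , y)
pair x y = unpair-onto (y + x) y x refl

ℕ↠ℕ×ℕ : ℕ ↠ (ℕ × ℕ)
ℕ↠ℕ×ℕ = mk↠ₛ {to = unpair} λ (x , y) → pair x y

tag : ℕ × ℕ → ℕ ⊎ ℕ
tag (zero  , n) = inj₁ n
tag (suc _ , n) = inj₂ n

ℕ↠ℕ⊎ℕ : ℕ ↠ (ℕ ⊎ ℕ)
ℕ↠ℕ⊎ℕ = mk↠ₛ {to = tag} [ (λ n → (0 , n) , refl) , (λ n → (1 , n) , refl) ] ↠-∘ ℕ↠ℕ×ℕ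

decodeList : ℕ → ℕ → List ℕ
decodeList zero    c = []
decodeList (suc k) c = proj₁ (unpair c) ∷ decodeList k (proj₂ (unpair c))

decodeList-onto : ∀ xs → ∃ λ ((k , c) : ℕ × ℕ) → decodeList k c ≡ xs
decodeList-onto []       = (0 , 0) , refl
decodeList-onto (x ∷ xs) with decodeList-onto xs
... | (k , c) , refl with pair x c
... | d , e = (suc k , d) , lemma
  where
  lemma : decodeList (suc k) d ≡ x ∷ decodeList k c
  lemma rewrite e = refl

ℕ↠List : ℕ ↠ List ℕ
ℕ↠List = mk↠ₛ {to = λ (k , c) → decodeList k c} decodeList-onto ↠-∘ ℕ↠ℕ×ℕ

-- Prefixes of sequences and names with a prescribed prefix.

≡[]-trans : ∀ {p q r n} → p ≡[ n ] q → q ≡[ n ] r → p ≡[ n ] r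
≡[]-trans e e′ i i<n = trans (e i i<n) (e′ i i<n)

≡[]-mono : ∀ {p q m n} → m ≤ n → p ≡[ n ] q → p ≡[ m ] q
≡[]-mono m≤n e i i<m = e i (≤-trans i<m m≤n)

bounded-collection : ∀ {a} {Q : ℕ → ℕ → Set a} → (∀ {n b b′} → b ≤ b′ → Q n b → Q n b′) →
                     (∀ n → ∃ (Q n)) → ∀ d → ∃ λ b → ∀ n → n < d → Q n b
bounded-collection mono h zero    = 0 , λ _ ()
bounded-collection {Q = Q} mono h (suc d) =
  let b , hb = bounded-collection mono h d
      c , hc = h d
  in b ⊔ c , λ n n<1+d → [ (λ n<d → mono (m≤m⊔n b c) (hb n n<d))
                         , (λ { refl → mono (m≤n⊔m b c) hc }) ] (m≤n⇒m<n∨m≡n (s≤s⁻¹ n<1+d))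

-- After `l` values of `p` the sequence `q` starts from its index 0, so that nothing it lists is
-- lost.
splice : ℕ → Baire → Baire → Baire
splice zero    p q         = q
splice (suc l) p q zero    = p zero
splice (suc l) p q (suc i) = splice l (p ∘ suc) q i

splice-agrees : ∀ l {p q} → p ≡[ l ] splice l p q
splice-agrees (suc l) zero    _         = refl
splice-agrees (suc l) (suc i) (s≤s i<l) = splice-agrees l i i<l

splice-tail : ∀ l {p q} i → ∃ λ j → splice l p q j ≡ q i
splice-tail zero    i = i , refl
splice-tail (suc l) i = let j , e = splice-tail l i in suc j , e

splice-values : ∀ l {p q : Baire} j →
                (∃ λ i → i < l × p i ≡ splice l p q j) ⊎ (∃ λ i → q i ≡ splice l p q j)
splice-values zero    j       = inj₂ (j , refl)
splice-values (suc l) zero    = inj₁ (zero , s≤s z≤n , refl)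
splice-values (suc l) (suc j) with splice-values l j
... | inj₁ (i , i<l , e) = inj₁ (suc i , s≤s i<l , e)
... | inj₂ found         = inj₂ found

splice-enumerates : ∀ {a} {S : Pred ℕ a} l {p q} → (∀ i n → i < l → p i ≡ suc n → n ∈ S) →
                    q Enumerates S → splice l p q Enumerates S
splice-enumerates {S = S} l {p} {q} prefix e n = mk⇔
  (λ (j , eq) → [ (λ (i , i<l , eq′) → prefix i n i<l (trans eq′ eq))
                , (λ (i , eq′) → Equivalence.to (e n) (i , trans eq′ eq)) ] (splice-values l j))
  (λ n∈S → let i , eq = Equivalence.from (e n) n∈S
               j , eq′ = splice-tail l i
           in j , trans eq′ eq)

-- Codes of basic open sets: 0 stands for the whole space and suc n for the
-- n-th basic set, in accordance with the convention of _Enumerates_.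

infix 4 _∈⁺_

_∈⁺_ : ℕ → Pred ℕ 0ℓ → Set
zero  ∈⁺ S = ⊤
suc n ∈⁺ S = n ∈ S

∈⁺-mono : ∀ {S T} c → S ⊆ T → c ∈⁺ S → c ∈⁺ T
∈⁺-mono zero    S⊆T _ = tt
∈⁺-mono (suc n) S⊆T h = S⊆T h

-- A union of subbasic Scott-open sets; it is the whole of `𝒫ℕ` as soon as `Q` contains the code 0.
Meets : Pred ℕ 0ℓ → Pred (Pred ℕ 0ℓ) (lsuc 0ℓ)
Meets Q S = Lift (lsuc 0ℓ) (∃ λ c → c ∈ Q × c ∈⁺ S)

Meets-open : ∀ Q → IsScottOpen (Meets Q)
Meets-open Q =
  (λ S⊆T (lift (c , q , h)) → lift (c , q , ∈⁺-mono c S⊆T h)) ,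
  (λ { F (i , _) (lift (zero  , q , _))       → i , lift (zero , q , tt)
     ; F _       (lift (suc n , q , (i , h))) → i , lift (suc n , q , h) })

-- Classical search along a sequence.

module Classical (lem : LEM) where

  stable : ∀ {a} {P : Set a} → ¬ ¬ P → P
  stable {a} = decidable-stable (lem a)

  -- Resizing to the lowest universe.
  Holds : ∀ {a} → Set a → Set
  Holds {a} P = True (lem a {P})

  holds : ∀ {a} {P : Set a} → P → Holds P
  holds = fromWitness

  held : ∀ {a} {P : Set a} → Holds P → P
  held = toWitness

  least : ∀ {a} (P : ℕ → Set a) → ∃ P → ∃ λ i → P i × (∀ j → j < i → ¬ P j)
  least {a} P (n , Pn) = below (suc n) n ≤-refl Pn
    where
    below : ∀ b n → n < b → P n → ∃ λ i → P i × (∀ j → j < i → ¬ P j)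
    below (suc b) n n<b Pn with lem a {∃ λ j → j < n × P j}
    ... | yes (j , j<n , Pj) = below b j (≤-trans j<n (s≤s⁻¹ n<b)) Pj
    ... | no none            = n , Pn , λ j j<n Pj → none (j , j<n , Pj)

  search : ∀ {a} → Pred ℕ a → Baire → ℕ
  search {a} R p with lem a {∃ λ i → R (p i) × (∀ j → j < i → ¬ R (p j))}
  ... | yes (i , _) = p i
  ... | no  _       = 0

  search-least : ∀ {a} (R : Pred ℕ a) q {i} → R (q i) → (∀ j → j < i → ¬ R (q j)) →
                 search R q ≡ q i
  search-least {a} R q {i} Ri min with lem a {∃ λ i → R (q i) × (∀ j → j < i → ¬ R (q j))}
  ... | no none = ⊥-elim (none (i , Ri , min))
  ... | yes (j , Rj , min′) with <-cmp i j
  ...   | tri< i<j _ _  = ⊥-elim (min′ i i<j Ri)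
  ...   | tri≈ _ refl _ = refl
  ...   | tri> _ _ j<i  = ⊥-elim (min j j<i Rj)

  -- The first hit and the failures before it are visible in the first `suc i` values, so this
  -- classically defined search is continuous.
  search-continuous : ∀ {a} (R : Pred ℕ a) p → (∃ λ i → R (p i)) →
                      ∃ λ i → R (p i) × (∀ q → p ≡[ suc i ] q → search R q ≡ p i)
  search-continuous R p found with least (R ∘ p) found
  ... | i , Ri , min = i , Ri , λ q e →
    trans (search-least R q (subst R (e i ≤-refl) Ri)
                        (λ j j<i → min j j<i ∘ subst R (sym (e j (m≤n⇒m≤1+n j<i)))))
          (sym (e i ≤-refl))

  indicate : ∀ {a} → Set a → ℕ → ℕ
  indicate {a} P n = if does (lem a {P}) then suc n else 0

  indicate-true : ∀ {a} {P : Set a} n → P → indicate P n ≡ suc n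
  indicate-true {a} {P} n x with lem a {P}
  ... | yes _  = refl
  ... | no ¬P = contradiction x ¬P

  indicate-inv : ∀ {a} {P : Set a} m {n} → indicate P m ≡ suc n → P × m ≡ n
  indicate-inv {a} {P} m eq with lem a {P}
  indicate-inv m refl | yes x = x , refl

  -- Coded basic sets and embeddings into the power set.

  module Coding {c ℓ p} (X : TopologicalSpace c ℓ p) (basis : CountableBasis X) where
    open TopologicalSpace X
    open CountableBasis basis

    C : ℕ → Subset
    C zero    = λ _ → ⊤
    C (suc n) = B n

    C-open : ∀ a → IsOpen (C a)
    C-open zero    = open-⊤
    C-open (suc n) = B-open n

    open-if-locally-basic : {U : Subset} → (∀ {x} → x ∈ U → ∃ λ n → x ∈ B n × B n ⊆ U) → IsOpen U
    open-if-locally-basic {U} local = open-resp-≐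
      ( (λ (lift (n , B⊆U) , x∈B) → held B⊆U x∈B)
      , (λ x∈U → let n , x∈B , B⊆U = local x∈U in lift (n , holds (λ {_} → B⊆U)) , x∈B))
      (open-⋃ {I = Lift (c ⊔ˡ ℓ) (∃ λ n → Holds (B n ⊆ U))} {U = λ (lift (n , _)) → B n}
              (λ (lift (n , _)) → B-open n))

    B-refine : ∀ {x U V} → IsOpen U → IsOpen V → x ∈ U → x ∈ V →
               ∃ λ n → x ∈ B n × B n ⊆ U × B n ⊆ V
    B-refine oU oV x∈U x∈V =
      let n , x∈B , B⊆U∩V = B-basis (open-∩ oU oV) (x∈U , x∈V)
      in n , x∈B , proj₁ ∘ B⊆U∩V , proj₂ ∘ B⊆U∩V

    code-listed : ∀ {x q} → q Enumerates (λ n → x ∈ B n) → ∀ i → x ∈ C (q i)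
    code-listed {x} {q} e i with q i in eq
    ... | zero  = tt
    ... | suc n = Equivalence.to (e n) (i , eq)

    module Approximation (f : Carrier → Pred ℕ 0ℓ)
             (f-local : ∀ {x j} → j ∈ f x → ∃ λ n → x ∈ B n × (∀ {z} → z ∈ B n → j ∈ f z)) where

      core : ℕ → Pred ℕ 0ℓ
      core a j = Holds (∀ z → z ∈ C a → j ∈ f z)

      core⊆ : ∀ {a x} → x ∈ C a → core a ⊆ f x
      core⊆ x∈C h = held h _ x∈C

      core-antitone : ∀ {a b} → C a ⊆ C b → core b ⊆ core a
      core-antitone C⊆ h = holds λ z z∈C → held h z (C⊆ z∈C)

      -- `f x` is the directed union of the cores of the basic neighbourhoods of `x`, so one of
      -- these cores is in `W`; shrinking its basic set into `U` only enlarges the core.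
      core-approximates : ∀ {W} → IsScottOpen W → ∀ {x} → f x ∈ W → ∀ {U} → IsOpen U → x ∈ U →
                          ∃ λ n → x ∈ B n × B n ⊆ U × core (suc n) ∈ W
      core-approximates (up , inacc) {x} fx∈W {U} oU x∈U =
        let (n , x∈B) , core∈W  = inacc family directed (up covers fx∈W)
            k , x∈k , k⊆U , k⊆n = B-refine oU (B-open n) x∈U (held x∈B)
        in k , x∈k , k⊆U , up (λ {j} → core-antitone {suc k} {suc n} k⊆n {j}) core∈W
        where
        I : Set
        I = ∃ λ n → Holds (x ∈ B n)

        family : I → Pred ℕ 0ℓ
        family (n , _) = core (suc n)

        directed : IsDirected family
        directed =
          (let n , x∈B , _ = B-basis oU x∈U in n , holds x∈B) ,
          λ (m , x∈m) (n , x∈n) →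
            let k , x∈k , k⊆m , k⊆n = B-refine (B-open m) (B-open n) (held x∈m) (held x∈n)
            in (k , holds x∈k) , (λ {j} → core-antitone {suc k} {suc m} k⊆m {j})
                               , (λ {j} → core-antitone {suc k} {suc n} k⊆n {j})

        covers : f x ⊆ ⋃ I family
        covers j∈fx = let n , x∈B , h = f-local j∈fx in (n , holds x∈B) , holds λ z → h

    basic-filter : Carrier → Pred ℕ 0ℓ
    basic-filter x n = Holds (x ∈ B n)

    ∈C⇒∈⁺ : ∀ {x} a → x ∈ C a → a ∈⁺ basic-filter x
    ∈C⇒∈⁺ zero    _   = tt
    ∈C⇒∈⁺ (suc n) x∈B = holds x∈B

    ∈⁺⇒∈C : ∀ {x} a → a ∈⁺ basic-filter x → x ∈ C a
    ∈⁺⇒∈C zero    _  = tt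
    ∈⁺⇒∈C (suc n) n∈ = held n∈

    basic-filter-cong : ∀ {x y} → x ≈ y → basic-filter x ⊆ basic-filter y
    basic-filter-cong x≈y {n} x∈B = holds (open-resp-≈ (B-open n) x≈y (held x∈B))

    -- The specialization order of a T₁-space is trivial, so already an inclusion of filters
    -- identifies the points.
    basic-filter-injective : T₁ X → ∀ {x y} → basic-filter x ⊆ basic-filter y → x ≈ y
    basic-filter-injective t₁ ⊆y = stable λ x≉y →
      let U , oU , x∈U , y∉U = t₁ x≉y
          n , x∈B , B⊆U      = B-basis oU x∈U
      in y∉U (B⊆U (held (⊆y {n} (holds x∈B))))

    embedding : T₁ X → (P : Pred (Pred ℕ 0ℓ) (lsuc 0ℓ)) → (∀ x → basic-filter x ∈ P) →
                (∀ {S} → S ∈ P → ∃ λ x → S ≐ basic-filter x) → X ≅ Subspace 𝒫ℕ P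
    embedding t₁ P filter∈P realized = record
      { bijection = record
        { to        = to
        ; from      = from
        ; to-cong   = λ x≈y → (λ {n} → basic-filter-cong x≈y {n}) ,
                              (λ {n} → basic-filter-cong (≈.sym x≈y) {n})
        ; from-cong = λ {S} {T} → from-cong S T
        ; inverse   = (λ {S} {x} → inverseˡ S x) , (λ {x} {S} → inverseʳ x S)
        }
      ; to-continuous   = to-continuous
      ; from-continuous = from-continuous
      }
      where
      module ≈ = Setoid points
      module Z = TopologicalSpace (Subspace 𝒫ℕ P)

      to : Carrier → Z.Carrier
      to x = basic-filter x , filter∈P x

      from : Z.Carrier → Carrier
      from (S , S∈P) = proj₁ (realized S∈P)

      S≐from : ∀ S → proj₁ S ≐ basic-filter (from S)
      S≐from (S , S∈P) = proj₂ (realized S∈P)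

      from-cong : ∀ S T → proj₁ S ≐ proj₁ T → from S ≈ from T
      from-cong S T (S⊆T , _) = basic-filter-injective t₁
        (λ {n} → proj₁ (S≐from T) {n} ∘ S⊆T ∘ proj₂ (S≐from S))

      inverseˡ : ∀ S x → x ≈ from S → basic-filter x ≐ proj₁ S
      inverseˡ S x x≈ = (λ {n} → proj₂ (S≐from S) ∘ basic-filter-cong x≈ {n}) ,
                        (λ {n} → basic-filter-cong (≈.sym x≈) {n} ∘ proj₁ (S≐from S))

      inverseʳ : ∀ x S → proj₁ S ≐ basic-filter x → from S ≈ x
      inverseʳ x S (S⊆ , _) = basic-filter-injective t₁ (λ {n} → S⊆ {n} ∘ proj₂ (S≐from S))

      module E = Approximation basic-filter
        (λ {x} {j} x∈B → j , held x∈B , λ z∈B → holds z∈B)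

      to-continuous : IsContinuous X (Subspace 𝒫ℕ P) to
      to-continuous V (W , oW , V⊆W , W⊆V) =
        (λ x → Lift (c ⊔ˡ ℓ) (Holds (basic-filter x ∈ W))) ,
        open-if-locally-basic (λ { (lift x∈) →
          let n , x∈B , _ , core∈W = E.core-approximates oW (held x∈) open-⊤ tt
          in n , x∈B , λ z∈B → lift (holds (proj₁ oW (E.core⊆ {suc n} z∈B) core∈W)) }) ,
        (λ { (lift x∈) → W⊆V (held x∈) }) , (λ x∈V → lift (holds (V⊆W x∈V)))

      from-continuous : IsContinuous (Subspace 𝒫ℕ P) X from
      from-continuous V oV =
        Inside ∘ proj₁ , (Inside , Meets-open _ , id , id) ,
        (λ {S} → inside⇒ S) , (λ {S} y∈V →
          let n , y∈B , B⊆V = B-basis oV y∈V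
          in lift (suc n , holds (λ {_} → B⊆V) , proj₂ (S≐from S) (holds y∈B)))
        where
        Inside : Pred (Pred ℕ 0ℓ) (lsuc 0ℓ)
        Inside = Meets (λ a → Holds (C a ⊆ V))

        inside⇒ : ∀ S → proj₁ S ∈ Inside → from S ∈ V
        inside⇒ S (lift (a , C⊆V , a∈)) =
          held C⊆V (∈⁺⇒∈C a (∈⁺-mono a (λ {n} → proj₁ (S≐from S) {n}) a∈))

-- Overt choice on a quasi-Polish space.

module Overt (lem : LEM) {c ℓ p} {X : TopologicalSpace c ℓ p} (basis : CountableBasis X)
             {P : TopologicalSpace.Subset 𝒫ℕ} {U V : ℕ → TopologicalSpace.Subset 𝒫ℕ}
             (U-open : ∀ n → IsScottOpen (U n)) (V-open : ∀ n → IsScottOpen (V n))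
             (P≐ : P ≐ (λ S → ∀ n → S ∈ U n → S ∈ V n)) (X≅P : X ≅ Subspace 𝒫ℕ P) where
  open TopologicalSpace X
  open CountableBasis basis
  open Classical lem
  open Coding X basis
  open ClosedSet

  private
    module Z = TopologicalSpace (Subspace 𝒫ℕ P)
    module h = _≅_ X≅P
    module ≈ = Setoid points

  f : Carrier → Pred ℕ 0ℓ
  f x = proj₁ (h.to x)

  f-satisfies : ∀ x n → f x ∈ U n → f x ∈ V n
  f-satisfies x = proj₁ P≐ (proj₂ (h.to x))

  f-local : ∀ {x j} → j ∈ f x → ∃ λ n → x ∈ B n × (∀ {z} → z ∈ B n → j ∈ f z)
  f-local {x} {j} j∈fx =
    let O , oO , O⊆ , ⊆O  = h.to-continuous (λ S → Meets (_≡ suc j) (proj₁ S))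
                              (Meets (_≡ suc j) , Meets-open _ , id , id)
        n , x∈B , B⊆O     = B-basis oO (⊆O (lift (suc j , refl , j∈fx)))
    in n , x∈B , λ z∈B → contains (O⊆ (B⊆O z∈B))
    where
    contains : ∀ {S} → S ∈ Meets (_≡ suc j) → j ∈ S
    contains (lift (_ , refl , j∈S)) = j∈S

  open Approximation f f-local

  -- scott-trace oO is a Scott-open set of 𝒫ℕ whose trace on P is O.

  pulled-back : ∀ {O : Subset} → IsOpen O → Σ[ W ∈ Z.Subset ] (Z.IsOpen W × W ≐ (h.from ⊢ O))
  pulled-back {O} = h.from-continuous O

  scott-trace : ∀ {O} → IsOpen O → Pred (Pred ℕ 0ℓ) (lsuc 0ℓ)
  scott-trace oO = proj₁ (proj₁ (proj₂ (pulled-back oO)))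

  scott-trace-open : ∀ {O} (oO : IsOpen O) → IsScottOpen (scott-trace oO)
  scott-trace-open oO = proj₁ (proj₂ (proj₁ (proj₂ (pulled-back oO))))

  from-trace : ∀ {O} (oO : IsOpen O) S → proj₁ S ∈ scott-trace oO → h.from S ∈ O
  from-trace oO S = proj₁ (proj₂ (proj₂ (pulled-back oO))) ∘
                    proj₂ (proj₂ (proj₂ (proj₁ (proj₂ (pulled-back oO)))))

  to-trace : ∀ {O} (oO : IsOpen O) S → h.from S ∈ O → proj₁ S ∈ scott-trace oO
  to-trace oO S = proj₁ (proj₂ (proj₂ (proj₁ (proj₂ (pulled-back oO))))) ∘
                  proj₂ (proj₂ (proj₂ (pulled-back oO)))

  -- The t-th step serves the condition U n ⇒ V n with n = proj₂ (unpair t), so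
  -- that every condition is served at arbitrarily late steps (unpair-fst).

  Improves : ℕ → ℕ → ℕ → Set (c ⊔ˡ ℓ ⊔ˡ lsuc 0ℓ)
  Improves t a b = C b ⊆ C a × (core a ∈ U n → core b ∈ V n)
    where n = proj₂ (unpair t)

  state : Baire → ℕ → ℕ
  -- Code 0 is the whole space, which meets every nonempty `A`.
  state q zero    = 0
  state q (suc t) = search (Improves t (state q t)) q

  NamesNonempty : Pred Baire (lsuc (c ⊔ˡ ℓ) ⊔ˡ p)
  NamesNonempty q = Σ[ A ∈ ClosedSet X ] (q Enumerates (λ n → B n ≬ set A) × ∃ (_∈ set A))

  module _ {q : Baire} (A : ClosedSet X) (e : q Enumerates (λ n → B n ≬ set A))
           (inhabited : ∃ (_∈ set A)) where

    listed-hits : ∀ i → C (q i) ≬ set A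
    listed-hits i with q i in eq
    ... | zero  = proj₁ inhabited , tt , proj₂ inhabited
    ... | suc n = Equivalence.to (e n) (i , eq)

    -- If `core a` is in `U n`, so is the larger `f x`; hence `f x` is in `V n`, and so is the core
    -- of some basic neighbourhood of `x`. As this neighbourhood meets `A` in `x`, the name `q`
    -- lists it.
    improvable : ∀ t a → C a ≬ set A → ∃ λ i → Improves t a (q i)
    improvable t a (x , x∈C , x∈A) = found (lem _ {core a ∈ U n})
      where
      n = proj₂ (unpair t)

      at : ∀ {m} → x ∈ B m → (∀ i → q i ≡ suc m → Improves t a (q i)) → ∃ λ i → Improves t a (q i)
      at {m} x∈B ok = let i , eq = Equivalence.from (e m) (x , x∈B , x∈A) in i , ok i eq

      found : Dec (core a ∈ U n) → ∃ λ i → Improves t a (q i)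
      found (no ∉U) = let m , x∈B , B⊆C = B-basis (C-open a) x∈C
        in at x∈B λ i eq → subst (Improves t a) (sym eq) (B⊆C , λ ∈U → contradiction ∈U ∉U)
      found (yes ∈U) =
        let fx∈V = f-satisfies x n (proj₁ (U-open n) (core⊆ {a} x∈C) ∈U)
            m , x∈B , B⊆C , core∈V = core-approximates (V-open n) fx∈V (C-open a) x∈C
        in at x∈B λ i eq → subst (Improves t a) (sym eq) (B⊆C , λ _ → core∈V)

    state-hits : ∀ t → C (state q t) ≬ set A
    next : ∀ t → ∃ λ i → Improves t (state q t) (q i) ×
                 (∀ r → q ≡[ suc i ] r → search (Improves t (state q t)) r ≡ q i)
    state-hits zero    = proj₁ inhabited , tt , proj₂ inhabited
    state-hits (suc t) with next t
    ... | i , _ , eq = subst (λ a → C a ≬ set A) (sym (eq q λ _ _ → refl)) (listed-hits i)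
    next t = search-continuous (Improves t (state q t)) q (improvable t (state q t) (state-hits t))

    state-improves : ∀ t → Improves t (state q t) (state q (suc t))
    state-improves t = let i , improves , eq = next t
      in subst (Improves t (state q t)) (sym (eq q λ _ _ → refl)) improves

    state-continuous : ∀ t → ∃ λ m → ∀ r → q ≡[ m ] r → state q t ≡ state r t
    state-continuous zero    = 0 , λ _ _ → refl
    state-continuous (suc t) =
      let m , hm      = state-continuous t
          i , _ , hi  = next t
      in m ⊔ suc i , λ r q≡r →
        trans (hi q λ _ _ → refl)
          (trans (sym (hi r (≡[]-mono (m≤n⊔m m (suc i)) q≡r)))
                 (cong (λ a → search (Improves t a) r) (hm r (≡[]-mono (m≤m⊔n m (suc i)) q≡r))))

    core-step : ∀ t → core (state q t) ⊆ core (state q (suc t))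
    core-step t = core-antitone {state q (suc t)} {state q t} (proj₁ (state-improves t))

    core-mono : ∀ {s t} → s ≤ t → core (state q s) ⊆ core (state q t)
    core-mono {s} {t} s≤t with m≤n⇒∃[o]m+o≡n s≤t
    ... | o , refl = go o
      where
      go : ∀ o → core (state q s) ⊆ core (state q (s + o))
      go zero    {j} j∈ = subst (λ k → j ∈ core (state q k)) (sym (+-identityʳ s)) j∈
      go (suc o) {j} j∈ = subst (λ k → j ∈ core (state q k)) (sym (+-suc s o)) (core-step (s + o) (go o j∈))

    limit : Pred ℕ 0ℓ
    limit = ⋃ ℕ (core ∘ state q)

    directed : IsDirected (core ∘ state q)
    directed = 0 , λ s t → s ⊔ t , core-mono (m≤m⊔n s t) , core-mono (m≤n⊔m s t)

    limit∈P : limit ∈ P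
    limit∈P = proj₂ P≐ λ n limit∈U →
      let s , core∈U = proj₂ (U-open n) (core ∘ state q) directed limit∈U
          -- Step `t` serves condition `n` and comes no earlier than stage `s`.
          t , eq     = pair s n
          s≤t        = subst (_≤ t) (cong proj₁ eq) (unpair-fst t)
          core∈V     = subst (λ m → core (state q t) ∈ U m → core (state q (suc t)) ∈ V m)
                         (cong proj₂ eq) (proj₂ (state-improves t))
                         (proj₁ (U-open n) (core-mono s≤t) core∈U)
      in proj₁ (V-open n) (suc t ,_) core∈V

    point : Carrier
    point = h.from (limit , limit∈P)

    trace-approximated : ∀ {O} (oO : IsOpen O) → point ∈ O → ∃ λ t → core (state q t) ∈ scott-trace oO
    trace-approximated oO point∈O =
      proj₂ (scott-trace-open oO) (core ∘ state q) directed (to-trace oO (limit , limit∈P) point∈O)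

    point-approximated : ∀ {O} (oO : IsOpen O) t → core (state q t) ∈ scott-trace oO → point ∈ O
    point-approximated oO t h =
      from-trace oO (limit , limit∈P) (proj₁ (scott-trace-open oO) (t ,_) h)

    point∈A : point ∈ set A
    point∈A = stable λ point∉A →
      let t , core∈W    = trace-approximated (∁-open A) point∉A
          y , y∈C , y∈A = state-hits t
          fy∈W          = proj₁ (scott-trace-open (∁-open A)) (core⊆ {state q t} y∈C) core∈W
      in from-trace (∁-open A) (h.to y) fy∈W
           (set-resp-≈ A (≈.sym (Inverse.strictlyInverseʳ h.bijection y)) y∈A)

  entry : ℕ → ℕ → ℕ
  entry a n = indicate (core a ∈ scott-trace (B-open n)) n

  entry-sound : ∀ a m {n} → entry a m ≡ suc n → core a ∈ scott-trace (B-open m) × m ≡ n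
  entry-sound a m = indicate-inv {P = core a ∈ scott-trace (B-open m)} m

  entry-complete : ∀ a n → core a ∈ scott-trace (B-open n) → entry a n ≡ suc n
  entry-complete a n = indicate-true {P = core a ∈ scott-trace (B-open n)} n

  -- Index `i` codes a stage and a basic set, which is listed if the core at that stage already
  -- forces the point into it. Each value thus depends on one stage only.
  output : Baire → Baire
  output q i = entry (state q (proj₁ (unpair i))) (proj₂ (unpair i))

  output-sound : ∀ q i {n} → output q i ≡ suc n →
                 core (state q (proj₁ (unpair i))) ∈ scott-trace (B-open n)
  output-sound q i eq =
    let core∈W , m≡n = entry-sound (state q (proj₁ (unpair i))) (proj₂ (unpair i)) eq
    in subst (λ m → core (state q (proj₁ (unpair i))) ∈ scott-trace (B-open m)) m≡n core∈W

  output-complete : ∀ q t n → core (state q t) ∈ scott-trace (B-open n) → ∃ λ i → output q i ≡ suc n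
  output-complete q t n core∈W = map₂
    (λ eq → trans (cong (λ tm → entry (state q (proj₁ tm)) (proj₂ tm)) eq)
                  (entry-complete (state q t) n core∈W))
    (pair t n)

  selector : ContinuousPartialMap (lsuc (c ⊔ˡ ℓ) ⊔ˡ p)
  selector = record
    { dom        = NamesNonempty
    ; dom-resp   = λ q≗r (A , e , inhabited) → A , enumerates-resp q≗r (id , id) e , inhabited
    ; map        = λ q _ → output q
    ; continuous = λ q (A , e , inhabited) n →
        let m , hm = bounded-collection
              {Q = λ i m → ∀ r → q ≡[ m ] r → output q i ≡ output r i}
              (λ m≤m′ h r q≡r → h r (≡[]-mono m≤m′ q≡r))
              (λ i → let m , h = state-continuous A e inhabited (proj₁ (unpair i))
                     in m , λ r q≡r → cong (λ a → entry a (proj₂ (unpair i))) (h r q≡r))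
              n
        in m , λ r _ q≡r i i<n → hm i i<n r q≡r
    }

  output-enumerates : ∀ {q x} →
                      (∀ n → x ∈ B n → ∃ λ t → core (state q t) ∈ scott-trace (B-open n)) →
                      (∀ n t → core (state q t) ∈ scott-trace (B-open n) → x ∈ B n) →
                      output q Enumerates (λ n → x ∈ B n)
  output-enumerates {q} approximated sound n = mk⇔
    (λ (i , eq) → sound n (proj₁ (unpair i)) (output-sound q i eq))
    (λ x∈B → let t , core∈W = approximated n x∈B in output-complete q t n core∈W)

  VC-continuous : (t₀ : T₀ X) → Continuous (VC lem basis t₀)
  VC-continuous t₀ = selector , λ q A e inhabited →
    (A , e , inhabited) , point A e inhabited ,
    output-enumerates (λ n → trace-approximated A e inhabited (B-open n))
                      (λ n → point-approximated A e inhabited (B-open n)) ,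
    point∈A A e inhabited

-- Choquet game positions extracted from a realizer of overt choice.

module Choquet (lem : LEM) {c ℓ p} {X : TopologicalSpace c ℓ p} (basis : CountableBasis X)
               (t₁ : T₁ X) {d} (F : ContinuousPartialMap d)
               (realizes : IsRealizer F (VC lem basis (T₁⇒T₀ X t₁))) where
  open TopologicalSpace X
  open CountableBasis basis
  open Classical lem
  open Coding X basis
  open ClosedSet

  private
    module F = ContinuousPartialMap F
    module ≈ = Setoid points

  Names : Baire → Carrier → Set (c ⊔ˡ ℓ)
  Names q x = q Enumerates (λ n → x ∈ B n)

  NamesHits : Baire → Subset → Set (c ⊔ˡ ℓ)
  NamesHits q A = q Enumerates (λ n → B n ≬ A)

  empty : ClosedSet X
  empty = record
    { set        = λ _ → ⊥
    ; set-resp-≈ = λ _ ()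
    ; ∁-open     = open-resp-≐ ((λ _ ()) , (λ _ → tt)) open-⊤
    }

  adjoin : ClosedSet X → Carrier → ClosedSet X
  adjoin E x = record
    { set        = λ z → z ∈ set E ⊎ z ≈ x
    ; set-resp-≈ = λ { z≈w (inj₁ z∈E) → inj₁ (set-resp-≈ E z≈w z∈E)
                     ; z≈w (inj₂ z≈x) → inj₂ (≈.trans (≈.sym z≈w) z≈x) }
    ; ∁-open     = open-if-locally-basic λ z∉ →
        -- T₁ is what makes finite sets closed.
        let U , oU , z∈U , x∉U      = t₁ (z∉ ∘ inj₂)
            n , z∈B , B⊆∁E , B⊆U    = B-refine (∁-open E) oU (z∉ ∘ inj₁) z∈U
        in n , z∈B , λ w∈B → λ { (inj₁ w∈E) → B⊆∁E w∈B w∈E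
                               ; (inj₂ w≈x) → x∉U (open-resp-≈ oU w≈x (B⊆U w∈B)) }
    }

  closure : Subset → ClosedSet X
  closure A = record
    { set        = λ z → ∀ n → z ∈ B n → B n ≬ A
    ; set-resp-≈ = λ z≈w h n w∈B → h n (open-resp-≈ (B-open n) (≈.sym z≈w) w∈B)
    ; ∁-open     = open-if-locally-basic λ {z} z∉ → stable λ none →
        z∉ λ n z∈B → stable λ disjoint → none (n , z∈B , λ w∈B w∈cl → disjoint (w∈cl n w∈B))
    }

  choose : ∀ {q} A → NamesHits q (set A) → ∃ (_∈ set A) →
           Σ[ q∈ ∈ q ∈ F.dom ] ∃ λ y → Names (F.map q q∈) y × y ∈ set A
  choose {q} A = realizes q A

  extend : ∀ q l A → ∃ (_∈ set A) → (∀ i n → i < l → q i ≡ suc n → B n ≬ set A) →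
           ∃ λ r → q ≡[ l ] r × NamesHits r (set A) ×
           Σ[ r∈ ∈ r ∈ F.dom ] ∃ λ y → Names (F.map r r∈) y × y ∈ set A
  extend q l A inhabited prefix =
    let q′ , e = enumerable lem (λ n → B n ≬ set A)
        e′     = splice-enumerates l prefix e
    in splice l q q′ , splice-agrees l , e′ , choose A e′ inhabited

  -- No sequence that shares the first `k` values of `q` can name a point of `E`.
  Excludes : Baire → ℕ → ClosedSet X → Set (c ⊔ˡ ℓ)
  Excludes q k E = ∀ {z} → z ∈ set E → ∃ λ i → i < k × z ∉ C (q i)

  Excludes-resp : ∀ E {q r : Baire} {k k′} → k ≤ k′ → q ≡[ k ] r → Excludes q k E → Excludes r k′ E
  Excludes-resp E k≤k′ q≡r excl {z} z∈E =
    let i , i<k , z∉ = excl z∈E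
    in i , ≤-trans i<k k≤k′ , subst (λ a → z ∉ C a) (q≡r i i<k) z∉

  remaining-point : ∀ E {x y} {q : Baire} {k} → Names q y → y ∈ set (adjoin E x) → Excludes q k E → Names q x
  remaining-point E names (inj₁ y∈E) excl =
    let i , _ , y∉ = excl y∈E in ⊥-elim (y∉ (code-listed names i))
  remaining-point E names (inj₂ y≈x) excl = enumerates-resp (λ _ → refl)
    ( (λ {n} → open-resp-≈ (B-open n) y≈x) , (λ {n} → open-resp-≈ (B-open n) (≈.sym y≈x))) names

  neighbourhood : ∀ {x O} → IsOpen O → x ∈ O → ∀ (q : Baire) l →
                  ∃ λ n → x ∈ B n × B n ⊆ O × (∀ i → i < l → x ∈ C (q i) → B n ⊆ C (q i))
  neighbourhood oO x∈O q zero =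
    let n , x∈B , B⊆O = B-basis oO x∈O in n , x∈B , B⊆O , λ _ ()
  neighbourhood {x} {O} oO x∈O q (suc l) =
    refine (neighbourhood oO x∈O q l) (lem _ {x ∈ C (q l)})
    where
    Below : ℕ → ℕ → Set (c ⊔ˡ ℓ)
    Below n l = ∀ i → i < l → x ∈ C (q i) → B n ⊆ C (q i)

    below-suc : ∀ {n} → Below n l → (x ∈ C (q l) → B n ⊆ C (q l)) → Below n (suc l)
    below-suc below at-l i i<1+l with m≤n⇒m<n∨m≡n (s≤s⁻¹ i<1+l)
    ... | inj₁ i<l  = below i i<l
    ... | inj₂ refl = at-l

    refine : (∃ λ n → x ∈ B n × B n ⊆ O × Below n l) → Dec (x ∈ C (q l)) →
             ∃ λ n → x ∈ B n × B n ⊆ O × Below n (suc l)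
    refine (n , x∈B , B⊆O , below) (no x∉C) =
      n , x∈B , B⊆O , below-suc {n} below (λ x∈C → contradiction x∈C x∉C)
    refine (n , x∈B , B⊆O , below) (yes x∈C) =
      let m , x∈m , m⊆n , m⊆C = B-refine (B-open n) (C-open (q l)) x∈B x∈C
      in m , x∈m , B⊆O ∘ m⊆n , below-suc {m} (λ i i<l x∈ → below i i<l x∈ ∘ m⊆n) (λ _ → m⊆C)

  -- A position of the Choquet game: `name` lists the sets hit by the points
  -- played so far, the realizer has already discarded all of them but `current`
  -- within its first k outputs, and these depend only on the first l inputs.
  -- Replacing `current` by any other point of C code is compatible with both.

  record Position : Set (lsuc (c ⊔ˡ ℓ) ⊔ˡ p ⊔ˡ d) where
    field
      previous   : ClosedSet X
      current    : Carrier
      name       : Baire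
      name∈      : name ∈ F.dom
      k l age    : ℕ
      code       : ℕ

    points-played : Subset
    points-played = set (adjoin previous current)

    out : Baire
    out = F.map name name∈

    field
      name-hits    : NamesHits name points-played
      out-names    : Names out current
      modulus      : ∀ r r∈ → name ≡[ l ] r → out ≡[ k ] F.map r r∈
      excludes     : Excludes out k previous
      current∈     : current ∈ C code
      code⊆inputs  : ∀ i → i < l → current ∈ C (name i) → C code ⊆ C (name i)
      code⊆outputs : ∀ i → i < k → C code ⊆ C (out i)
      age≤k        : age ≤ k
      age≤l        : age ≤ l
      hits-listed  : ∀ n → n < age → B n ≬ points-played → ∃ λ i → i < l × name i ≡ suc n
      out-listed   : ∀ n → n < age → current ∈ B n → ∃ λ i → i < k × out i ≡ suc n

  open Position

  infix 4 _⟶_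

  -- The growth of `age` makes infinite runs fair: all entries of input and output become fixed, and
  -- every basic set that is due gets listed.
  _⟶_ : Position → Position → Set (c ⊔ˡ ℓ)
  s ⟶ s′ = l s ≤ l s′ × name s ≡[ l s ] name s′ × points-played s ⊆ points-played s′ × age s < age s′

  listing-bound : ∀ {a} {S : Pred ℕ a} {q} → q Enumerates S → ∀ b →
                  ∃ λ m → ∀ n → n < b → n ∈ S → ∃ λ i → i < m × q i ≡ suc n
  listing-bound {S = S} {q} e = bounded-collection
    (λ m≤m′ h n∈S → let i , i<m , eq = h n∈S in i , ≤-trans i<m m≤m′ , eq)
    (λ n → bound (lem _ {n ∈ S}))
    where
    bound : ∀ {n} → Dec (n ∈ S) → ∃ λ m → n ∈ S → ∃ λ i → i < m × q i ≡ suc n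
    bound {n} (yes n∈S) = let i , eq = Equivalence.from (e n) n∈S in suc i , λ _ → i , ≤-refl , eq
    bound     (no n∉S)  = 0 , λ n∈S → contradiction n∈S n∉S

  -- The number `k′` of outputs is fixed first, then a number `l′` of inputs that determines them,
  -- and last a basic set.
  settle : ∀ s E {x q} (q∈ : q ∈ F.dom) → NamesHits q (set (adjoin E x)) →
           Names (F.map q q∈) x → ∀ {k₀} → Excludes (F.map q q∈) k₀ E →
           name s ≡[ l s ] q → points-played s ⊆ set (adjoin E x) → ∀ {a} → x ∈ C a →
           ∃ λ m → x ∈ C m × C m ⊆ C a × Σ[ s′ ∈ Position ] (s ⟶ s′ × code s′ ≡ m)
  settle s E {x} {q} q∈ hits names {k₀} excl agrees played {a} x∈C =
    let b                       = suc (age s)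
        k₁ , out-listed₁        = listing-bound names b
        k′                      = k₀ ⊔ (b ⊔ k₁)
        l₁ , hits-listed₁       = listing-bound hits b
        l₂ , modulus₂           = F.continuous q q∈ k′
        l′                      = (l s ⊔ b) ⊔ (l₁ ⊔ l₂)
        -- Shrink first into the input sets that contain `x`, then into the output sets, all of
        -- which contain `x`.
        n₁ , x∈₁ , ⊆a , inputs  = neighbourhood (C-open a) x∈C q l′
        n , x∈B , ⊆₁ , outputs  = neighbourhood (B-open n₁) x∈₁ (F.map q q∈) k′
        ls⊔b≤l′                 = m≤m⊔n (l s ⊔ b) (l₁ ⊔ l₂)
        l₁⊔l₂≤l′                = m≤n⊔m (l s ⊔ b) (l₁ ⊔ l₂)
        b⊔k₁≤k′                 = m≤n⊔m k₀ (b ⊔ k₁)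
        s′ = record
          { previous     = E
          ; current      = x
          ; name         = q
          ; name∈        = q∈
          ; k            = k′
          ; l            = l′
          ; age          = b
          ; code         = suc n
          ; name-hits    = hits
          ; out-names    = names
          ; modulus      = λ r r∈ e → modulus₂ r r∈ (≡[]-mono (≤-trans (m≤n⊔m l₁ l₂) l₁⊔l₂≤l′) e)
          ; excludes     = Excludes-resp E {F.map q q∈} (m≤m⊔n k₀ (b ⊔ k₁)) (λ _ _ → refl) excl
          ; current∈     = x∈B
          ; code⊆inputs  = λ i i<l x∈ → inputs i i<l x∈ ∘ ⊆₁
          ; code⊆outputs = λ i i<k → outputs i i<k (code-listed names i)
          ; age≤k        = ≤-trans (m≤m⊔n b k₁) b⊔k₁≤k′
          ; age≤l        = ≤-trans (m≤n⊔m (l s) b) ls⊔b≤l′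
          ; hits-listed  = λ n n<b h → map₂ (λ (i<l₁ , eq) →
              ≤-trans i<l₁ (≤-trans (m≤m⊔n l₁ l₂) l₁⊔l₂≤l′) , eq) (hits-listed₁ n n<b h)
          ; out-listed   = λ n n<b h → map₂ (λ (i<k₁ , eq) →
              ≤-trans i<k₁ (≤-trans (m≤n⊔m b k₁) b⊔k₁≤k′) , eq) (out-listed₁ n n<b h)
          }
    in suc n , x∈B , ⊆a ∘ ⊆₁ , s′ ,
       (≤-trans (m≤m⊔n (l s) b) ls⊔b≤l′ , agrees , played , ≤-refl) , refl

  -- The old point is first replaced by the new one, until the realizer has
  -- discarded the old point; only then the old point is added again.

  move : ∀ s {x} → x ∈ C (code s) → ∀ {a} → x ∈ C a →
         ∃ λ m → x ∈ C m × C m ⊆ C a × Σ[ s′ ∈ Position ] (s ⟶ s′ × code s′ ≡ m)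
  move s {x} x∈code {a} x∈C with lem _ {current s ≈ x}
  ... | yes same =
    let m , y∈m , m⊆a , rest = settle s (previous s) (name∈ s) (name-hits s) (out-names s) (excludes s)
                                 (λ _ _ → refl) id {a} (open-resp-≈ (C-open a) (≈.sym same) x∈C)
    in m , open-resp-≈ (C-open m) same y∈m , m⊆a , rest
  ... | no differ =
    let E                                     = previous s
        q₁ , agrees₁ , hits₁ , q₁∈ , y₁ , names-y₁ , y₁∈ =
          extend (name s) (l s) (adjoin E x) (x , inj₂ ≈.refl) compatible
        out≡₁                                 = modulus s q₁ q₁∈ agrees₁
        excl₁                                 = Excludes-resp E ≤-refl out≡₁ (excludes s)
        names₁                                = remaining-point E names-y₁ y₁∈ excl₁
        -- The output names `x`, so it lists a basic set inside a neighbourhood of `x` that omits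
        -- the old point; this entry discards the old point.
        U , oU , x∈U , old∉U                  = t₁ (differ ∘ ≈.sym)
        j , x∈j , j⊆U                         = B-basis oU x∈U
        i , out-i                             = Equivalence.from (names₁ j) x∈j
        k₁                                    = k s ⊔ suc i
        l₁ , modulus₁                         = F.continuous q₁ q₁∈ k₁
        old∉i                                 = λ z∈ → old∉U (j⊆U (subst (λ a → current s ∈ C a) out-i z∈))
        excl-old                              = λ {z} → Excludes-adjoin E {F.map q₁ q₁∈} {k s} excl₁ i old∉i {z}
        -- Long enough to fix that output prefix and to keep the inputs promised by `s`.
        l₂                                    = l s ⊔ l₁
        q₂ , agrees₂ , hits₂ , q₂∈ , y₂ , names-y₂ , y₂∈ =
          extend q₁ l₂ (adjoin (adjoin E (current s)) x) (x , inj₂ ≈.refl)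
            (λ i n _ eq → map₂ (map₂ [ inj₁ ∘ inj₁ , inj₂ ]′) (Equivalence.to (hits₁ n) (i , eq)))
        out≡₂                                 = modulus₁ q₂ q₂∈ (≡[]-mono (m≤n⊔m (l s) l₁) agrees₂)
        excl₂                                 = Excludes-resp (adjoin E (current s)) ≤-refl out≡₂ excl-old
    in settle s (adjoin E (current s)) q₂∈ hits₂
         (remaining-point (adjoin E (current s)) names-y₂ y₂∈ excl₂) excl₂
         (≡[]-trans agrees₁ (≡[]-mono (m≤m⊔n (l s) l₁) agrees₂)) inj₁ {a} x∈C
    where
    -- A listed set that contains the old point also contains `x`, by `code⊆inputs`.
    compatible : ∀ i n → i < l s → name s i ≡ suc n → B n ≬ set (adjoin (previous s) x)
    compatible i n i<l eq with Equivalence.to (name-hits s n) (i , eq)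
    ... | z , z∈B , inj₁ z∈E = z , z∈B , inj₁ z∈E
    ... | z , z∈B , inj₂ z≈old = x , x∈B , inj₂ ≈.refl
      where
      old∈ : current s ∈ C (name s i)
      old∈ = subst (λ a → current s ∈ C a) (sym eq) (open-resp-≈ (B-open n) z≈old z∈B)

      x∈B : x ∈ B n
      x∈B = subst (λ a → x ∈ C a) eq (code⊆inputs s i i<l old∈ x∈code)

    Excludes-adjoin : ∀ E {q : Baire} {k y} → Excludes q k E → ∀ i → y ∉ C (q i) →
                      Excludes q (k ⊔ suc i) (adjoin E y)
    Excludes-adjoin E {k = k} excl i y∉ (inj₁ z∈E) =
      let j , j<k , z∉ = excl z∈E in j , ≤-trans j<k (m≤m⊔n k (suc i)) , z∉
    Excludes-adjoin E {q} {k} excl i y∉ (inj₂ z≈y) =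
      i , m≤n⊔m k (suc i) , y∉ ∘ open-resp-≈ (C-open (q i)) z≈y

  root : Carrier → Position
  root x =
    let q , _ , hits , q∈ , y , names , y∈ =
          extend (λ _ → 0) 0 (adjoin empty x) (x , inj₂ ≈.refl) (λ _ _ ())
    in record
      { previous     = empty
      ; current      = x
      ; name         = q
      ; name∈        = q∈
      ; k            = 0
      ; l            = 0
      ; age          = 0
      ; code         = 0
      ; name-hits    = hits
      ; out-names    = remaining-point empty {k = 0} names y∈ λ ()
      ; modulus      = λ _ _ _ _ ()
      ; excludes     = λ ()
      ; current∈     = tt
      ; code⊆inputs  = λ _ ()
      ; code⊆outputs = λ _ ()
      ; age≤k        = z≤n
      ; age≤l        = z≤n
      ; hits-listed  = λ _ ()
      ; out-listed   = λ _ ()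
      }

  -- Infinite runs of the game.

  module Run (b : ℕ → Position) (b-step : ∀ t → b t ⟶ b (suc t)) where

    age-grows : ∀ t → t ≤ age (b t)
    age-grows zero    = z≤n
    age-grows (suc t) = ≤-trans (s≤s (age-grows t)) (proj₂ (proj₂ (proj₂ (b-step t))))

    Later : ℕ → ℕ → Set (c ⊔ˡ ℓ)
    Later s t = l (b s) ≤ l (b t) × name (b s) ≡[ l (b s) ] name (b t) ×
                points-played (b s) ⊆ points-played (b t)

    later+ : ∀ s o → Later s (o + s)
    later+ s zero    = ≤-refl , (λ _ _ → refl) , id
    later+ s (suc o) =
      let l≤ , agrees , played        = later+ s o
          l≤′ , agrees′ , played′ , _ = b-step (o + s)
      in ≤-trans l≤ l≤′ , ≡[]-trans agrees (≡[]-mono l≤ agrees′) , played′ ∘ played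

    later : ∀ {s t} → s ≤ t → Later s t
    later {s} s≤t = subst (Later s) (m∸n+n≡m s≤t) (later+ s _)

    limit-name : Baire
    -- At stage `suc i` the fixed prefix, of length at least `age`, already includes index `i`.
    limit-name i = name (b (suc i)) i

    limit-agrees : ∀ t → name (b t) ≡[ l (b t) ] limit-name
    limit-agrees t i i<l with ≤-total t (suc i)
    ... | inj₁ t≤ = proj₁ (proj₂ (later t≤)) i i<l
    ... | inj₂ ≤t = sym (proj₁ (proj₂ (later ≤t)) i (≤-trans (age-grows (suc i)) (age≤l (b (suc i)))))

    all-points : Subset
    all-points z = ∃ λ t → z ∈ points-played (b t)

    -- A basic set meets the closure only if it meets a point played, and `hits-listed` lists it
    -- once `age` exceeds `n`.
    limit-hits : NamesHits limit-name (set (closure all-points))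
    limit-hits n = mk⇔
      (λ (i , eq) → let z , z∈B , z∈ = Equivalence.to (name-hits (b (suc i)) n) (i , eq)
                    in z , z∈B , λ m z∈m → z , z∈m , suc i , z∈)
      (λ (w , w∈B , w∈cl) →
        let z , z∈B , t , z∈ = w∈cl n w∈B
            t′               = t ⊔ suc n
            i , i<l , eq     = hits-listed (b t′) n (≤-trans (m≤n⊔m t (suc n)) (age-grows t′))
                                 (z , z∈B , proj₂ (proj₂ (later (m≤m⊔n t (suc n)))) z∈)
        in i , trans (sym (limit-agrees t′ i i<l)) eq)

    chosen : Σ[ q∈ ∈ limit-name ∈ F.dom ] ∃ λ y →
             Names (F.map limit-name q∈) y × y ∈ set (closure all-points)
    chosen = choose (closure all-points) limit-hits
      (current (b 0) , λ n x∈B → current (b 0) , x∈B , 0 , inj₂ ≈.refl)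

    outcome : Carrier
    outcome = proj₁ (proj₂ chosen)

    outcome-named : Names (F.map limit-name (proj₁ chosen)) outcome
    outcome-named = proj₁ (proj₂ (proj₂ chosen))

    out-agrees : ∀ t → out (b t) ≡[ k (b t) ] F.map limit-name (proj₁ chosen)
    out-agrees t = modulus (b t) limit-name (proj₁ chosen) (limit-agrees t)

    -- The current point at stage `suc t` lies in `C t`, so `out-listed` places this set among the
    -- outputs already fixed, which the limit inherits.
    outcome∈ : ∀ t → C (code (b (suc t))) ⊆ C t → outcome ∈ C t
    outcome∈ zero    _  = tt
    outcome∈ (suc n) ⊆B =
      let s            = b (suc (suc n))
          i , i<k , eq = out-listed s n (≤-trans (n≤1+n (suc n)) (age-grows (suc (suc n)))) (⊆B (current∈ s))
      in Equivalence.to (outcome-named n) (i , trans (sym (out-agrees (suc (suc n)) i i<k)) eq)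

    -- The output entry that lists `n` is fixed at some stage, and the open set played there lies in
    -- all outputs fixed so far.
    outcome-neighbourhoods : ∀ n → outcome ∈ B n → ∃ λ t → C (code (b t)) ⊆ B n
    outcome-neighbourhoods n y∈B =
      let i , eq = Equivalence.from (outcome-named n) y∈B
          i<k    = ≤-trans (age-grows (suc i)) (age≤k (b (suc i)))
      in suc i , λ {z} z∈ → subst (λ a → z ∈ C a) (trans (out-agrees (suc i) i i<k) eq)
                              (code⊆outputs (b (suc i)) i i<k z∈)

  -- The countable game tree and its Π⁰₂ set of filters.

  module Tree (x₀ : Carrier) where

    -- One child for each basic set that occurs as the code of a successor: the
    -- open sets of these countably many children cover as much as those of all
    -- successors, which is all that the conditions below need.

    child : Position → ℕ → Position
    child s m with lem _ {Σ[ s′ ∈ Position ] (s ⟶ s′ × code s′ ≡ m)}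
    ... | yes (s′ , _) = s′
    -- This default never passes `IsChild`, because `⟶` strictly increases `age`.
    ... | no  _        = s

    IsChild : Position → ℕ → Set (c ⊔ˡ ℓ)
    IsChild s m = s ⟶ child s m × code (child s m) ≡ m

    child-correct : ∀ s m → Σ[ s′ ∈ Position ] (s ⟶ s′ × code s′ ≡ m) → IsChild s m
    child-correct s m found with lem _ {Σ[ s′ ∈ Position ] (s ⟶ s′ × code s′ ≡ m)}
    ... | yes (_ , correct) = correct
    ... | no  none          = contradiction found none

    node : List ℕ → Position
    node []       = root x₀
    node (m ∷ ms) = child (node ms) m

    -- inj₁: S is closed upwards.  inj₂: a node whose open set belongs to S has a
    -- child inside C n whose open set belongs to S, for every n in S.

    Condition : Set
    Condition = (ℕ × ℕ) ⊎ (List ℕ × ℕ)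

    conditions : ℕ ↠ Condition
    conditions = (ℕ↠ℕ×ℕ ⊎-↠ ((ℕ↠List ×-↠ ↠-id ℕ) ↠-∘ ℕ↠ℕ×ℕ)) ↠-∘ ℕ↠ℕ⊎ℕ

    premise conclusion : Condition → Pred (Pred ℕ 0ℓ) (lsuc 0ℓ)
    premise (inj₁ (m , n))     = Meets (λ a → a ≡ m × Holds (C m ⊆ C n))
    premise (inj₂ (ms , n))    = Meets (_≡ n) ∩ Meets (_≡ code (node ms))
    conclusion (inj₁ (m , n))  = Meets (_≡ n)
    conclusion (inj₂ (ms , n)) = Meets (λ m → Holds (IsChild (node ms) m × C m ⊆ C n))

    premise-open : ∀ i → IsScottOpen (premise i)
    premise-open (inj₁ _)        = Meets-open _
    premise-open (inj₂ (ms , n)) = TopologicalSpace.open-∩ 𝒫ℕ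
      {Meets (_≡ n)} {Meets (_≡ code (node ms))} (Meets-open _) (Meets-open _)

    conclusion-open : ∀ i → IsScottOpen (conclusion i)
    conclusion-open (inj₁ _) = Meets-open _
    conclusion-open (inj₂ _) = Meets-open _

    Ideal : Pred (Pred ℕ 0ℓ) (lsuc 0ℓ)
    Ideal S = ∀ i → S ∈ premise (Surjection.to conditions i) → S ∈ conclusion (Surjection.to conditions i)

    Ideal-Π⁰₂ : IsΠ⁰₂ 𝒫ℕ Ideal
    Ideal-Π⁰₂ = premise ∘ Surjection.to conditions , conclusion ∘ Surjection.to conditions ,
      premise-open ∘ Surjection.to conditions , conclusion-open ∘ Surjection.to conditions , id , id

    Ideal-all : ∀ {S} → S ∈ Ideal → ∀ i → S ∈ premise i → S ∈ conclusion i
    Ideal-all {S} S∈ i = subst (λ i → S ∈ premise i → S ∈ conclusion i)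
      (Surjection.to∘to⁻ conditions i) (S∈ (Surjection.to⁻ conditions i))

    points-ideal : ∀ x → basic-filter x ∈ Ideal
    points-ideal x i = satisfied (Surjection.to conditions i)
      where
      satisfied : ∀ i → basic-filter x ∈ premise i → basic-filter x ∈ conclusion i
      satisfied (inj₁ (m , n)) (lift (_ , (refl , m⊆n) , m∈)) =
        lift (n , refl , ∈C⇒∈⁺ n (held m⊆n (∈⁺⇒∈C m m∈)))
      satisfied (inj₂ (ms , n)) (lift (_ , refl , n∈) , lift (_ , refl , s∈)) =
        -- A point in both the node's open set and `C n` is a legal move of the opponent, and `move`
        -- answers it.
        let m , x∈m , m⊆n , found = move (node ms) (∈⁺⇒∈C (code (node ms)) s∈) {n} (∈⁺⇒∈C n n∈)
        in lift (m , holds (child-correct (node ms) m found , λ {_} → m⊆n) , ∈C⇒∈⁺ m x∈m)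

    module Branch {S : Pred ℕ 0ℓ} (S∈ : S ∈ Ideal) where

      Visited : Set
      Visited = ∃ λ ms → code (node ms) ∈⁺ S

      -- Step `t` aims at `C t` if its code belongs to `S` and at the whole space otherwise, so
      -- every element of `S` gets its turn.
      target : ∀ t → ∃ λ n → n ∈⁺ S × (t ∈⁺ S → n ≡ t)
      target t with lem _ {t ∈⁺ S}
      ... | yes t∈ = t , t∈ , λ _ → refl
      ... | no  t∉ = 0 , tt , λ t∈ → contradiction t∈ t∉

      next : ∀ t (v : Visited) → Σ[ w ∈ Visited ]
             (node (proj₁ v) ⟶ node (proj₁ w) × (t ∈⁺ S → C (code (node (proj₁ w))) ⊆ C t))
      next t (ms , s∈) with target t
      ... | n , n∈ , n≡t
        with Ideal-all S∈ (inj₂ (ms , n)) (lift (n , refl , n∈) , lift (code (node ms) , refl , s∈))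
      ... | lift (m , good , m∈) with held good
      ... | (step , code≡m) , m⊆n =
        (m ∷ ms , subst (_∈⁺ S) (sym code≡m) m∈) , step , λ t∈ {z} z∈ →
          subst (λ a → z ∈ C a) (n≡t t∈) (m⊆n (subst (λ a → z ∈ C a) code≡m z∈))

      visited : ℕ → Visited
      visited zero    = [] , tt
      visited (suc t) = proj₁ (next t (visited t))

      open Run (λ t → node (proj₁ (visited t))) (λ t → proj₁ (proj₂ (next t (visited t))))

      realized : ∃ λ y → S ≐ basic-filter y
      realized = outcome ,
        -- The element `n` has code `suc n` and is served at step `suc n`.
        (λ {n} n∈S → holds (outcome∈ (suc n) (proj₂ (proj₂ (next (suc n) (visited (suc n)))) n∈S))) ,
        (λ {n} y∈B → let t , ⊆B = outcome-neighbourhoods n (held y∈B)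
                     in upward n (Ideal-all S∈ (inj₁ (code (node (proj₁ (visited t))) , suc n))
                          (lift (_ , (refl , holds (λ {_} → ⊆B)) , proj₂ (visited t)))))
        where
        upward : ∀ n → S ∈ Meets (_≡ suc n) → n ∈ S
        upward n (lift (_ , refl , n∈S)) = n∈S

  quasi-Polish : IsQuasiPolish X
  quasi-Polish with lem _ {Carrier}
  ... | yes x₀ = let open Tree x₀ in
    Ideal , Ideal-Π⁰₂ , embedding t₁ Ideal points-ideal λ S∈ → Branch.realized S∈
  -- Without a point there is no root; the empty Π⁰₂ set has all of `𝒫ℕ` as premise and the empty
  -- set as conclusion.
  ... | no uninhabited =
    (λ S → ℕ → S ∈ Meets (λ _ → ⊤) → S ∈ Meets (λ _ → ⊥)) ,
    ((λ _ → Meets (λ _ → ⊤)) , (λ _ → Meets (λ _ → ⊥)) ,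
     (λ _ → Meets-open _) , (λ _ → Meets-open _) , id , id) ,
    embedding t₁ _ (⊥-elim ∘ uninhabited) λ h → impossible (h 0 (lift (0 , tt , tt)))
    where
    impossible : ∀ {a} {A : Set a} {S} → S ∈ Meets (λ _ → ⊥) → A
    impossible (lift (_ , () , _))

corollary23 : ∀ (lem : LEM) {c ℓ p} (X : TopologicalSpace c ℓ p) (basis : CountableBasis X) (t₁ : T₁ X) →
    IsQuasiPolish X ⇔ Continuous (VC lem basis (T₁⇒T₀ X t₁))
corollary23 lem X basis t₁ = mk⇔
  (λ { (P , (U , V , U-open , V-open , P≐) , X≅P) →
       Overt.VC-continuous lem basis {U = U} {V} U-open V-open P≐ X≅P (T₁⇒T₀ X t₁) })
  (λ (F , realizes) → Choquet.quasi-Polish lem basis t₁ F realizes)
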